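{- Let $G=(V,E)$ be a graph, $\prec$ a strict partial order on $P_f(\mathbb{N}^+)$, and $\sigma$ an ordering of $V$. Then there exists an ordering $\tau$ of $V$ with $\sigma=\mathrm{TBLS}(G,\prec,\tau)$ if and only if $\sigma=\mathrm{TBLS}(G,\prec,\sigma)$.
   Context: Let $G=(V,E)$ be a finite undirected graph with $n$ vertices. An ordering of $V$ is a bijection $\sigma:\{1,\dots,n\}\to V$; $\sigma(i)$ is the $i$th vertex. $P_f(\mathbb{N}^+)$ is the set of finite subsets of the positive integers. Given a strict partial order $\prec$ on $P_f(\mathbb{N}^+)$ and an ordering $\tau$ of $V$, the Tie-Breaking Label Search $\mathrm{TBLS}(G,\prec,\tau)$ is the procedure: set $label(v)=\emptyset$ for every $v$; for $i=1,\dots,n$: let Eligible be the set of unnumbered vertices $x$ such that there is no unnumbered vertex $y$ with $label(x)\prec label(y)$; let $v$ be the first vertex of Eligible in the ordering $\tau$; set $\sigma(i)=v$ ($v$ becomes numbered); for every unnumbered neighbour $w$ of $v$ replace $label(w)$ by $label(w)\cup\{i\}$. The output is $\sigma$. -}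

module Defs where

open import Data.Bool.Base using (if_then_else_; _∧_)
open import Data.Fin.Base as Fin using (Fin)
import Data.Fin.Properties as Fin
import Data.Fin.Induction as Fin
open import Data.List.Base using (List; []; _∷_; length)
open import Data.List.Membership.Propositional using (_∈_; _∉_)
import Data.List.Membership.DecPropositional as DecMembership
open import Data.List.Relation.Binary.BagAndSetEquality using (_∼[_]_; set)
open import Data.List.Relation.Unary.Any as Any using (here; there)
open import Data.Nat.Base as ℕ using (ℕ; zero; suc; NonZero)
import Data.Nat.Properties as ℕ
open import Data.Product.Base using (∃; ∃-syntax; _×_; _,_; proj₁; proj₂)
open import Data.Vec.Base using (Vec; []; _∷_; tabulate; lookup)
open import Data.Vec.Properties using (tabulate∘lookup; lookup∘tabulate)
open import Data.Vec.Relation.Unary.All as All using (All; []; _∷_)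
open import Data.Vec.Relation.Unary.AllPairs using ([]; _∷_)
open import Data.Vec.Relation.Unary.Unique.Propositional using (Unique)
open import Data.Vec.Relation.Unary.Unique.Propositional.Properties using (lookup-injective)
import Data.Vec.Membership.DecPropositional as DecMembershipᵛ
import Data.Vec.Relation.Unary.Any as Anyᵛ
import Data.Vec.Relation.Unary.Any.Properties as Anyᵛ
open import Data.Vec.Membership.Propositional using () renaming (_∈_ to _∈ᵛ_)
open import Function.Base using (_∘_; flip; _on_)
open import Function.Bundles using (_↔_; Inverse; mk↔ₛ′; module Injection)
open import Function.Properties.Inverse using (↔-sym; ↔⇒↣)
open import Induction.WellFounded using (Acc; acc)
open import Level using (Level)
open import Relation.Binary.Core using (Rel)
open import Relation.Binary.Definitions using (Decidable; DecidableEquality; Symmetric)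
open import Relation.Binary.PropositionalEquality
  using (_≡_; _≢_; _≗_; refl; sym; trans; cong; subst; module ≡-Reasoning)
open import Relation.Binary.Structures using (IsStrictPartialOrder)
open import Relation.Nullary.Decidable
  using (Dec; yes; no; does; via-injection; map′; ¬?; _×-dec_; decidable-stable)
open import Relation.Nullary.Negation using (¬_; contradiction)

private
  variable
    ℓ : Level
    k n : ℕ

ℕ⁺ : Set
ℕ⁺ = ∃ NonZero

1⁺ : ℕ⁺
1⁺ = 1 , _

suc⁺ : ℕ⁺ → ℕ⁺
suc⁺ (i , _) = suc i , _

-- P_f(ℕ⁺) is the setoid (FiniteSubset , _≈_): lists up to having the same
-- elements.  A relation on P_f(ℕ⁺) is one on lists that respects _≈_, which is
-- part of IsStrictPartialOrder _≈_.
FiniteSubset : Set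
FiniteSubset = List ℕ⁺

infix 4 _≈_

_≈_ : Rel FiniteSubset _
A ≈ B = A ∼[ set ] B

record Graph (n : ℕ) : Set₁ where
  infix 4 _~_ _~?_
  field
    V        : Set
    vertices : Fin n ↔ V
    _~_      : Rel V _
    _~?_     : Decidable _~_
    ~-sym    : Symmetric _~_

  _≟_ : DecidableEquality V
  _≟_ = via-injection (↔⇒↣ (↔-sym vertices)) Fin._≟_

Ordering : Graph n → Set
Ordering {n} G = Fin n ↔ Graph.V G

infix 4 _≤[_]_

_≤[_]_ : {V : Set} → V → Fin n ↔ V → V → Set
x ≤[ τ ] y = Inverse.from τ x Fin.≤ Inverse.from τ y

module Search {n} (G : Graph n) (_≺_ : Rel FiniteSubset ℓ) where
  open Graph G
  open DecMembership _≟_ using (_∉?_)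

  record State : Set where
    field
      numbered : List V
      label    : V → FiniteSubset

  open State

  Unnumbered : State → V → Set
  Unnumbered s x = x ∉ numbered s

  Eligible : State → V → Set _
  Eligible s x = Unnumbered s x × ¬ (∃[ y ] Unnumbered s y × label s x ≺ label s y)

  FirstEligible : Ordering G → State → V → Set _
  FirstEligible τ s v = Eligible s v × (∀ x → Eligible s x → v ≤[ τ ] x)

  initial : State
  initial = record { numbered = [] ; label = λ _ → [] }

  number : ℕ⁺ → V → State → State
  number i v s = record
    { numbered = vs
    ; label    = λ w → if does (w ∉? vs) ∧ does (v ~? w) then i ∷ label s w else label s w
    }
    where vs = v ∷ numbered s

  -- Run τ i s vs: from state s, iterations i, i+1, … of the loop with tie-breaking
  -- order τ select the entries of vs, one each.
  data Run (τ : Ordering G) (i : ℕ⁺) (s : State) : Vec V k → Set ℓ where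
    []  : Run τ i s []
    _∷_ : ∀ {v} {vs : Vec V k} →
          FirstEligible τ s v → Run τ (suc⁺ i) (number i v s) vs → Run τ i s (v ∷ vs)

-- IsTBLS G _≺_ τ σ is the equation σ = TBLS(G, ≺, τ).  It is a relation because
-- _≺_ need not be decidable; TBLS-unique and TBLS-exists below show that, when
-- _≺_ is a decidable strict partial order, it is the graph of a function of τ.
IsTBLS : (G : Graph n) → Rel FiniteSubset ℓ → Ordering G → Ordering G → Set ℓ
IsTBLS G _≺_ τ σ = Run τ 1⁺ initial (tabulate (Inverse.to σ))
  where open Search G _≺_

module _ {n} (G : Graph n) (_≺_ : Rel FiniteSubset ℓ) (τ : Ordering G) where
  open Graph G
  open Search G _≺_
  open State
  open DecMembership _≟_ using (_∈?_; _∉?_)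
  private
    module τ = Inverse τ

    to∘from : ∀ x → τ.to (τ.from x) ≡ x
    to∘from = τ.strictlyInverseˡ

    from-injective : ∀ {x y} → τ.from x ≡ τ.from y → x ≡ y
    from-injective = Injection.injective (↔⇒↣ (↔-sym τ))

    to-injective : ∀ {x y} → τ.to x ≡ τ.to y → x ≡ y
    to-injective = Injection.injective (↔⇒↣ τ)

    Run-unique : ∀ {i s} {vs ws : Vec V k} → Run τ i s vs → Run τ i s ws → vs ≡ ws
    Run-unique [] [] = refl
    Run-unique ((ev , v-first) ∷ r) ((ew , w-first) ∷ r′)
      with refl ← from-injective (Fin.≤-antisym (v-first _ ew) (w-first _ ev))
      = cong (_ ∷_) (Run-unique r r′)

    tabulate-injective : ∀ {m} {f g : Fin m → V} → tabulate f ≡ tabulate g → f ≗ g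
    tabulate-injective {f = f} {g} eq i = begin
      f i                      ≡⟨ lookup∘tabulate f i ⟨
      lookup (tabulate f) i    ≡⟨ cong (flip lookup i) eq ⟩
      lookup (tabulate g) i    ≡⟨ lookup∘tabulate g i ⟩
      g i                      ∎
      where open ≡-Reasoning

  TBLS-unique : ∀ σ σ′ → IsTBLS G _≺_ τ σ → IsTBLS G _≺_ τ σ′ →
                Inverse.to σ ≗ Inverse.to σ′
  TBLS-unique σ σ′ r r′ = tabulate-injective (Run-unique r r′)

  module _ (isSPO : IsStrictPartialOrder _≈_ _≺_) (_≺?_ : Decidable _≺_) where
    private
      module SPO = IsStrictPartialOrder isSPO

      anyV? : ∀ {p} {P : V → Set p} → (∀ x → Dec (P x)) → Dec (∃ P)
      anyV? {P = P} P? = map′ (λ (j , p) → τ.to j , p)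
                              (λ (x , p) → τ.from x , subst P (sym (to∘from x)) p)
                              (Fin.any? (P? ∘ τ.to))

      dominated? : ∀ s x → Dec (∃[ y ] Unnumbered s y × label s x ≺ label s y)
      dominated? s x = anyV? λ y → (y ∉? numbered s) ×-dec (label s x ≺? label s y)

      eligible? : ∀ s x → Dec (Eligible s x)
      eligible? s x = (x ∉? numbered s) ×-dec ¬? (dominated? s x)

      unnumbered-exists : ∀ s → length (numbered s) ℕ.< n → ∃ (Unnumbered s)
      unnumbered-exists s lt with anyV? (λ x → x ∉? numbered s)
      ... | yes found = found
      ... | no none with Fin.pigeonhole lt (Any.index ∘ all∈)
        where
        all∈ : ∀ j → τ.to j ∈ numbered s
        all∈ j = decidable-stable (τ.to j ∈? numbered s) (λ ∉ → none (_ , ∉))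
      ...   | i , j , i<j , eq = contradiction (to-injective same) (Fin.<⇒≢ i<j)
        where
        index-injective : ∀ {x y} {xs : List V} (p : x ∈ xs) (q : y ∈ xs) →
                          Any.index p ≡ Any.index q → x ≡ y
        index-injective (here refl) (here refl) _  = refl
        index-injective (there p)   (there q)   eq = index-injective p q (Fin.suc-injective eq)

        same : τ.to i ≡ τ.to j
        same = index-injective _ _ eq

      eligible-exists : ∀ s → ∃ (Unnumbered s) → ∃ (Eligible s)
      eligible-exists s (x , x∉) =
        climb x x∉ (Fin.spo-noetherian onPositions (τ.from x))
        where
        import Relation.Binary.Construct.On as On

        _⊏_ : Rel (Fin n) ℓ
        _⊏_ = _≺_ on (label s ∘ τ.to)

        onPositions : IsStrictPartialOrder (_≈_ on (label s ∘ τ.to)) _⊏_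
        onPositions = On.isStrictPartialOrder (label s ∘ τ.to) isSPO

        climb : ∀ x → Unnumbered s x → Acc (flip _⊏_) (τ.from x) → ∃ (Eligible s)
        climb x x∉ (acc rec) with dominated? s x
        ... | no max = x , x∉ , max
        ... | yes (y , y∉ , x≺y) = climb y y∉ (rec x⊏y)
          where
          x⊏y : τ.from x ⊏ τ.from y
          x⊏y rewrite to∘from x | to∘from y = x≺y

      least : ∀ {m p} {P : Fin m → Set p} → (∀ i → Dec (P i)) → ∃ P →
              ∃[ i ] P i × (∀ j → P j → i Fin.≤ j)
      least {zero}  P? (() , _)
      least {suc m} {P = P} P? (i , p) with P? Fin.zero
      ... | yes p₀ = Fin.zero , p₀ , λ _ _ → ℕ.z≤n
      ... | no ¬p₀ with least (P? ∘ Fin.suc) (shift i p)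
        where
        shift : ∀ i → P i → ∃ (P ∘ Fin.suc)
        shift Fin.zero    p = contradiction p ¬p₀
        shift (Fin.suc i) p = i , p
      ...   | j , q , j≤ = Fin.suc j , q ,
              λ { Fin.zero p → contradiction p ¬p₀ ; (Fin.suc l) p → ℕ.s≤s (j≤ l p) }

      firstEligible-exists : ∀ s → ∃ (Eligible s) → ∃ (FirstEligible τ s)
      firstEligible-exists s (x , e)
        with least (eligible? s ∘ τ.to) (τ.from x , subst (Eligible s) (sym (to∘from x)) e)
      ... | j , e′ , j≤ = τ.to j , e′ , λ y ey →
            subst (Fin._≤ τ.from y) (sym (τ.strictlyInverseʳ j))
              (j≤ (τ.from y) (subst (Eligible s) (sym (to∘from y)) ey))

      run : ∀ k i s → length (numbered s) ℕ.+ k ≡ n →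
            ∃[ vs ] Run τ i s {k} vs × Unique vs × All (_∉ numbered s) vs
      run zero    i s _  = [] , [] , [] , []
      run (suc k) i s eq
        with v , f ← firstEligible-exists s (eligible-exists s (unnumbered-exists s
                       (subst (length (numbered s) ℕ.<_) eq (ℕ.m<m+n _ (ℕ.s≤s ℕ.z≤n)))))
        with vs , r , u , ∉s ← run k (suc⁺ i) (number i v s) (trans (sym (ℕ.+-suc _ k)) eq)
        = v ∷ vs , f ∷ r , All.map (λ ∉ → ∉ ∘ here ∘ sym) ∉s ∷ u
        , proj₁ (proj₁ f) ∷ All.map (_∘ there) ∉s

      toOrdering : (vs : Vec V n) → Unique vs → ∃ λ (σ : Ordering G) → tabulate (Inverse.to σ) ≡ vs
      toOrdering vs u = mk↔ₛ′ (lookup vs) position lookup-position position-lookup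
                      , tabulate∘lookup vs
        where
        open DecMembershipᵛ _≟_ using () renaming (_∈?_ to _∈ᵛ?_)

        ∉⇒All≢ : ∀ {m x} (ws : Vec V m) → ¬ (x ∈ᵛ ws) → All (x ≢_) ws
        ∉⇒All≢ []       _  = []
        ∉⇒All≢ (w ∷ ws) x∉ = x∉ ∘ Anyᵛ.here ∷ ∉⇒All≢ ws (x∉ ∘ Anyᵛ.there)

        covers : ∀ x → x ∈ᵛ vs
        covers x with x ∈ᵛ? vs
        ... | yes x∈ = x∈
        ... | no x∉ with Fin.pigeonhole (ℕ.n<1+n n) (τ.from ∘ lookup (x ∷ vs))
        ...   | i , j , i<j , eq = contradiction
                  (lookup-injective (fresh ∷ u) i j (from-injective eq)) (Fin.<⇒≢ i<j)
          where
          fresh : All (x ≢_) vs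
          fresh = ∉⇒All≢ vs x∉

        position : V → Fin n
        position x = Anyᵛ.index (covers x)

        lookup-position : ∀ x → lookup vs (position x) ≡ x
        lookup-position x = sym (Anyᵛ.lookup-index (covers x))

        position-lookup : ∀ j → position (lookup vs j) ≡ j
        position-lookup j = lookup-injective u _ _ (lookup-position (lookup vs j))

    TBLS-exists : ∃[ σ ] IsTBLS G _≺_ τ σ
    TBLS-exists with vs , r , u , _ ← run n 1⁺ initial refl
                with σ , eq ← toOrdering vs u
      = σ , subst (Run τ 1⁺ initial) (sym eq) r

{-# OPTIONS --safe #-}
module Submission where

-- TBLS(G, ≺, τ) and TBLS(G, ≺, σ) agree on which vertices are eligible in a given
-- state; only the tie-breaking differs.  When a run with output σ selects σ(i),
-- every unnumbered vertex is some σ(j) with j ≥ i, so σ(i) is also the first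
-- eligible vertex with respect to σ.

open import Defs
open import Data.Fin.Base as Fin using (Fin)
import Data.Fin.Properties as Fin
import Data.List.Relation.Unary.Any as Any
open import Data.Nat.Base using (ℕ; zero; suc; z<s; s<s)
import Data.Nat.Properties as ℕ
open import Data.Product.Base using (∃-syntax; _,_)
open import Data.Vec.Base using (Vec; []; _∷_; tabulate)
open import Data.Vec.Membership.Propositional using (_∈_)
open import Data.Vec.Membership.Propositional.Properties using (∈-tabulate⁺)
open import Data.Vec.Relation.Unary.All as All using ()
import Data.Vec.Relation.Unary.All.Properties as All
open import Data.Vec.Relation.Unary.AllPairs using (AllPairs; []; _∷_)
open import Data.Vec.Relation.Unary.Any using (here; there)
open import Function.Base using (_∘_)
open import Function.Bundles using (_⇔_; mk⇔; Inverse)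
open import Relation.Binary.Core using (Rel)
open import Relation.Binary.PropositionalEquality using (refl; sym; subst; subst₂)
open import Relation.Binary.Structures using (IsStrictPartialOrder)
open import Relation.Nullary.Negation using (contradiction)

-- `AllPairs` relates each entry only to later ones, so strictly increasing indices suffice.
tabulate⁺-< : ∀ {a r} {A : Set a} {R : Rel A r} {n} {f : Fin n → A} →
              (∀ {i j} → i Fin.< j → R (f i) (f j)) → AllPairs R (tabulate f)
tabulate⁺-< {n = zero}  f-mono = []
tabulate⁺-< {n = suc n} f-mono =
  All.tabulate⁺ (λ _ → f-mono z<s) ∷ tabulate⁺-< (f-mono ∘ s<s)

module _ {n} (G : Graph n) (σ : Ordering G) where
  open Inverse σ

  ordering-sorted : AllPairs (_≤[ σ ]_) (tabulate to)
  ordering-sorted = tabulate⁺-< λ {i} {j} i<j →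
    subst₂ Fin._≤_ (sym (strictlyInverseʳ i)) (sym (strictlyInverseʳ j)) (ℕ.<⇒≤ i<j)

  ordering-covers : ∀ x → x ∈ tabulate to
  ordering-covers x = subst (_∈ tabulate to) (strictlyInverseˡ x) (∈-tabulate⁺ to (from x))

module _ {ℓ n} (G : Graph n) (_≺_ : Rel FiniteSubset ℓ) where
  open Graph G
  open Search G _≺_

  -- Induction on the run. The two conditions on `vs` form the loop invariant, stated for an
  -- arbitrary state so that it passes to the tail; `number` updates the state independently of the
  -- tie-breaking order.
  Run-retie : ∀ {k i s} {vs : Vec V k} (τ σ : Ordering G) →
              AllPairs (_≤[ σ ]_) vs → (∀ x → Unnumbered s x → x ∈ vs) →
              Run τ i s vs → Run σ i s vs
  Run-retie τ σ [] covers [] = []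
  Run-retie {i = i} {s} {v ∷ vs} τ σ (v≤vs ∷ sorted) covers ((e , _) ∷ r) =
    -- Eligibility does not mention the order, so `e` carries over; any eligible rival `x` is
    -- unnumbered, hence in `v ∷ vs`, whose `σ`-least entry is `v`.
    (e , λ x (x∉ , _) → v≤ (covers x x∉)) ∷ Run-retie τ σ sorted covers′ r
    where
    v≤ : ∀ {x} → x ∈ v ∷ vs → v ≤[ σ ] x
    v≤ (here refl) = Fin.≤-refl
    v≤ (there x∈)  = All.lookup v≤vs x∈

    covers′ : ∀ x → Unnumbered (number i v s) x → x ∈ vs
    covers′ x x∉ with covers x (x∉ ∘ Any.there)
    ... | here x≡v = contradiction (Any.here x≡v) x∉
    ... | there x∈ = x∈

theorem2 : ∀ {ℓ} {n : ℕ} (G : Graph n)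
    (_≺_ : Rel FiniteSubset ℓ) → IsStrictPartialOrder _≈_ _≺_ →
    (σ : Ordering G) →
    (∃[ τ ] IsTBLS G _≺_ τ σ) ⇔ IsTBLS G _≺_ σ σ
theorem2 G _≺_ _ σ = mk⇔
  -- At the start `vs` is the whole of `σ`, so the invariant holds.
  (λ (τ , r) → Run-retie G _≺_ τ σ (ordering-sorted G σ) (λ x _ → ordering-covers G σ x) r)
  (σ ,_)
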